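{- Let $\mathfrak U$ be the category of updown categories (with morphisms of updown categories) and $\mathfrak U\mathfrak U$ its full subcategory of univalent updown categories. There are two functors $\mathfrak U\to\mathfrak U\mathfrak U$, taking an updown category $\mathcal C$ to $\mathcal C^{\uparrow}$ and to $\mathcal C^{\downarrow}$ respectively.
   Context: An updown category is a small category $\mathcal C$ with a rank functor $|\cdot|:\mathcal C\to\mathbb N$ (where $\mathbb N=\{0,1,2,\dots\}$ is the ordered set of natural numbers regarded as a category) such that: (A1) each rank $\mathcal C_n=\{p\in\operatorname{Ob}\mathcal C:|p|=n\}$ is finite; (A2) $\mathcal C_0$ consists of a single object $\hat 0$, and $\operatorname{Hom}(\hat 0,p)$ is nonempty for all objects $p$; (A3) for objects $p,p'$, $\operatorname{Hom}(p,p')$ is always finite, and $\operatorname{Hom}(p,p')=\emptyset$ unless $|p|<|p'|$ or $p=p'$; in the latter case $\operatorname{Hom}(p,p)$ is a group, denoted $\operatorname{Aut}(p)$; (A4) any morphism $p\to p'$ with $|p'|=|p|+k$ factors as a composition $p=p_0\to p_1\to\cdots\to p_k=p'$ with $|p_{i+1}|=|p_i|+1$; (A5) if $|p'|=|p|+1$, the actions of $\operatorname{Aut}(p)$ and $\operatorname{Aut}(p')$ on $\operatorname{Hom}(p,p')$ (by precomposition and postcomposition respectively) are free. $\mathcal C$ is univalent if $\operatorname{Aut}(p)$ is trivial for all $p\in\operatorname{Ob}\mathcal C$. A morphism of updown categories from $\mathcal C$ to $\mathcal D$ is a functor $F:\mathcal C\to\mathcal D$ with $|F(p)|=|p|$ for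 all $p\in\operatorname{Ob}\mathcal C$, such that the induced map $\operatorname{Aut}(p)\to\operatorname{Aut}(F(p))$ is injective for every object $p$ of $\mathcal C$, and such that for any $p,q\in\operatorname{Ob}\mathcal C$ with $|q|=|p|+1$ the induced maps $$\coprod_{\{q':F(q')=F(q)\}}\operatorname{Hom}(p,q')/\operatorname{Aut}(p)\to\operatorname{Hom}(F(p),F(q))/\operatorname{Aut}(F(p)),$$ $$\coprod_{\{q':F(q')=F(q)\}}\operatorname{Hom}(p,q')/\operatorname{Aut}(q')\to\operatorname{Hom}(F(p),F(q))/\operatorname{Aut}(F(q))$$ are injective. Given an updown category $\mathcal C$, the category $\mathcal C^{\uparrow}$ has $\operatorname{Ob}\mathcal C^{\uparrow}=\operatorname{Ob}\mathcal C$ with the same ranks; $\operatorname{Hom}_{\mathcal C^\uparrow}(p,p)$ is trivial for all $p$; and for $|p'|>|p|$, $\operatorname{Hom}_{\mathcal C^\uparrow}(p,p')$ is the set of equivalence classes in $\operatorname{Hom}_{\mathcal C}(p,p')$ under the equivalence relation generated by $f_nf_{n-1}\cdots f_1\sim\alpha_nf_n\cdots\alpha_1f_1$, where each $f_i$ is a morphism between adjacent ranks and $\alpha_i\in\operatorname{Aut}(\text{target of }f_i)$. Similarly, $\mathcal C^{\downarrow}$ has $\operatorname{Ob}\mathcal C^\downarrow=\operatorname{Ob}\mathcal C$ with the same ranks, trivial automorphisms, and for $|p'|>|p|$, $\operatorname{Hom}_{\mathcal C^\downarrow}(p,p')$ is the set of equivalence classes in $\operatorname{Hom}_{\mathcal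 C}(p,p')$ under the equivalence relation generated by $f_nf_{n-1}\cdots f_1\sim f_n\beta_nf_{n-1}\cdots f_1\beta_1$, where each $f_i$ is a morphism between adjacent ranks and $\beta_i\in\operatorname{Aut}(\text{source of }f_i)$. Composition in both is induced by composition in $\mathcal C$. -}

module Defs where

open import Level using (Level; _⊔_; 0ℓ) renaming (suc to lsuc)
open import Algebra.Structures using (IsGroup)
open import Data.Fin.Base using (Fin)
open import Data.Nat.Base using (ℕ; suc; _≤_; _<_)
open import Data.Nat.Properties using (≤-refl; ≤-trans; ≤-irrelevant; <⇒≤; <-trans)
open import Data.Product.Base using (Σ; Σ-syntax; ∃; ∃-syntax; _×_; _,_; proj₁; proj₂)
open import Data.Sum.Base using (_⊎_)
open import Function.Bundles using (Inverse; _↔_)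
open import Function.Definitions using (Injective)
open import Relation.Binary.Bundles using (Setoid)
open import Relation.Binary.Core using (Rel)
open import Relation.Binary.Structures using (IsEquivalence)
open import Relation.Binary.Construct.Closure.Equivalence using (EqClosure)
open import Relation.Binary.Construct.Closure.Transitive using (TransClosure; [_]; _∷_)
open import Relation.Binary.PropositionalEquality
  using (_≡_; refl; sym; trans; cong; subst; subst₂; setoid; isEquivalence)

-- Hom-sets are setoids, since quotients of hom-sets are needed below;
-- objects are compared with _≡_.

record RawCategory (o h e : Level) : Set (lsuc (o ⊔ h ⊔ e)) where
  infix  4 _≈_ _⇒_
  infixr 9 _∘_
  field
    Obj : Set o
    _⇒_ : Rel Obj h
    _≈_ : ∀ {p q} → Rel (p ⇒ q) e
    id  : ∀ {p} → p ⇒ p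
    _∘_ : ∀ {p q r} → q ⇒ r → p ⇒ q → p ⇒ r

record IsCategory {o h e} (C : RawCategory o h e) : Set (o ⊔ h ⊔ e) where
  open RawCategory C
  field
    equiv     : ∀ {p q} → IsEquivalence (_≈_ {p} {q})
    ∘-resp-≈  : ∀ {p q r} {g g′ : q ⇒ r} {f f′ : p ⇒ q} →
                g ≈ g′ → f ≈ f′ → g ∘ f ≈ g′ ∘ f′
    identityˡ : ∀ {p q} (f : p ⇒ q) → id ∘ f ≈ f
    identityʳ : ∀ {p q} (f : p ⇒ q) → f ∘ id ≈ f
    assoc     : ∀ {p q r s} (h : r ⇒ s) (g : q ⇒ r) (f : p ⇒ q) →
                (h ∘ g) ∘ f ≈ h ∘ (g ∘ f)

  hom-setoid : Obj → Obj → Setoid h e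
  hom-setoid p q = record { isEquivalence = equiv {p} {q} }

  module Eq {p q} = IsEquivalence (equiv {p} {q})

record Category (o h e : Level) : Set (lsuc (o ⊔ h ⊔ e)) where
  field
    raw        : RawCategory o h e
    isCategory : IsCategory raw
  open RawCategory raw public
  open IsCategory isCategory public

record RawFunctor {o h e o′ h′ e′}
                  (C : RawCategory o h e) (D : RawCategory o′ h′ e′) :
                  Set (o ⊔ h ⊔ o′ ⊔ h′) where
  private
    module C = RawCategory C
    module D = RawCategory D
  field
    F₀ : C.Obj → D.Obj
    F₁ : ∀ {p q} → p C.⇒ q → F₀ p D.⇒ F₀ q

record IsFunctor {o h e o′ h′ e′}
                 {C : RawCategory o h e} {D : RawCategory o′ h′ e′}
                 (F : RawFunctor C D) : Set (o ⊔ h ⊔ e ⊔ e′) where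
  private
    module C = RawCategory C
    module D = RawCategory D
  open RawFunctor F
  field
    resp-≈       : ∀ {p q} {f g : p C.⇒ q} → f C.≈ g → F₁ f D.≈ F₁ g
    identity     : ∀ {p} → F₁ (C.id {p}) D.≈ D.id
    homomorphism : ∀ {p q r} (g : q C.⇒ r) (f : p C.⇒ q) →
                   F₁ (g C.∘ f) D.≈ F₁ g D.∘ F₁ f

record Functor {o h e o′ h′ e′}
               (C : Category o h e) (D : Category o′ h′ e′) :
               Set (o ⊔ h ⊔ e ⊔ o′ ⊔ h′ ⊔ e′) where
  field
    raw       : RawFunctor (Category.raw C) (Category.raw D)
    isFunctor : IsFunctor raw
  open RawFunctor raw public
  open IsFunctor isFunctor public

-- Strict equality of functors (not natural isomorphism).
record _≋_ {o h e o′ h′ e′}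
           {C : RawCategory o h e} {D : RawCategory o′ h′ e′}
           (F G : RawFunctor C D) : Set (o ⊔ h ⊔ o′ ⊔ e′) where
  private
    module C = RawCategory C
    module D = RawCategory D
    module F = RawFunctor F
    module G = RawFunctor G
  field
    eq₀ : ∀ p → F.F₀ p ≡ G.F₀ p
    eq₁ : ∀ {p q} (f : p C.⇒ q) →
          subst₂ D._⇒_ (eq₀ p) (eq₀ q) (F.F₁ f) D.≈ G.F₁ f

infix 4 _≋_

idF : ∀ {o h e} {C : RawCategory o h e} → RawFunctor C C
idF = record { F₀ = λ p → p ; F₁ = λ f → f }

infixr 9 _∘F_

_∘F_ : ∀ {o h e o′ h′ e′ o″ h″ e″}
         {C : RawCategory o h e} {D : RawCategory o′ h′ e′} {E : RawCategory o″ h″ e″} →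
       RawFunctor D E → RawFunctor C D → RawFunctor C E
G ∘F F = record { F₀ = λ p → G.F₀ (F.F₀ p) ; F₁ = λ f → G.F₁ (F.F₁ f) }
  where
  module F = RawFunctor F
  module G = RawFunctor G

FullSubcategory : ∀ {o h e a} (C : Category o h e) → (Category.Obj C → Set a) →
                  Category (o ⊔ a) h e
FullSubcategory C P = record
  { raw = record
    { Obj = Σ Obj P
    ; _⇒_ = λ p q → proj₁ p ⇒ proj₁ q
    ; _≈_ = _≈_
    ; id  = id
    ; _∘_ = _∘_
    }
  ; isCategory = record
    { equiv     = equiv
    ; ∘-resp-≈  = ∘-resp-≈
    ; identityˡ = identityˡ
    ; identityʳ = identityʳ
    ; assoc     = assoc
    }
  }
  where open Category C

ℕ-≤ : Category 0ℓ 0ℓ 0ℓ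
ℕ-≤ = record
  { raw = record
    { Obj = ℕ
    ; _⇒_ = _≤_
    ; _≈_ = _≡_
    ; id  = ≤-refl
    ; _∘_ = λ n≤o m≤n → ≤-trans m≤n n≤o
    }
  ; isCategory = record
    { equiv     = isEquivalence
    ; ∘-resp-≈  = λ { refl refl → refl }
    ; identityˡ = λ _ → ≤-irrelevant _ _
    ; identityʳ = λ _ → ≤-irrelevant _ _
    ; assoc     = λ _ _ _ → ≤-irrelevant _ _
    }
  }

record RawRankedCategory (ℓ : Level) : Set (lsuc ℓ) where
  field
    category : RawCategory ℓ ℓ ℓ
    rank     : RawFunctor category (Category.raw ℕ-≤)

  open RawCategory category public

  ∣_∣ : Obj → ℕ
  ∣_∣ = RawFunctor.F₀ rank

  Aut : Obj → Set ℓ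
  Aut p = p ⇒ p

  -- Equality in Hom(p,q)/Aut(p) and in Hom(p,q)/Aut(q).
  _≈/source_ _≈/target_ : ∀ {p q} → Rel (p ⇒ q) ℓ
  _≈/source_ {p} {q} f g = Σ[ β ∈ Aut p ] f ∘ β ≈ g
  _≈/target_ {p} {q} f g = Σ[ α ∈ Aut q ] α ∘ f ≈ g

  Step : Rel Obj ℓ
  Step p q = Σ[ f ∈ p ⇒ q ] ∣ q ∣ ≡ suc ∣ p ∣

  -- A chain f₁ ∷ f₂ ∷ … ∷ [ fₙ ] has n ≥ 1 and first map f₁; a chain from
  -- p to q necessarily has length ∣ q ∣ ∸ ∣ p ∣.
  Chain : Rel Obj ℓ
  Chain = TransClosure Step

  compose : ∀ {p q} → Chain p q → p ⇒ q
  compose [ f , _ ]     = f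
  compose ((f , _) ∷ c) = compose c ∘ f

  TargetAuts SourceAuts : ∀ {p q} → Chain p q → Set ℓ
  TargetAuts {q = q} [ _ ]         = Aut q
  TargetAuts (_∷_ {y = q} _ c)     = Aut q × TargetAuts c
  SourceAuts {p} [ _ ]             = Aut p
  SourceAuts {p} (_ ∷ c)           = Aut p × SourceAuts c

  -- αₙ fₙ ⋯ α₁ f₁
  compose-target : ∀ {p q} (c : Chain p q) → TargetAuts c → p ⇒ q
  compose-target [ f , _ ]     α        = α ∘ f
  compose-target ((f , _) ∷ c) (α , αs) = compose-target c αs ∘ (α ∘ f)

  -- fₙ βₙ ⋯ f₁ β₁
  compose-source : ∀ {p q} (c : Chain p q) → SourceAuts c → p ⇒ q
  compose-source [ f , _ ]     β        = f ∘ β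
  compose-source ((f , _) ∷ c) (β , βs) = compose-source c βs ∘ (f ∘ β)

record IsUpdown {ℓ} (C : RawRankedCategory ℓ) : Set ℓ where
  open RawRankedCategory C
  field
    isCategory     : IsCategory category
    rank-isFunctor : IsFunctor rank
  open IsCategory isCategory public
  field
    rank-finite : ∀ n → ∃[ k ] ((Σ[ p ∈ Obj ] ∣ p ∣ ≡ n) ↔ Fin k)

    0̂        : Obj
    ∣0̂∣      : ∣ 0̂ ∣ ≡ 0
    0̂-unique : ∀ p → ∣ p ∣ ≡ 0 → p ≡ 0̂
    0̂⇒       : ∀ p → 0̂ ⇒ p

    hom-finite  : ∀ p q → ∃[ k ] Inverse (hom-setoid p q) (setoid (Fin k))
    hom-empty   : ∀ {p q} → p ⇒ q → (∣ p ∣ < ∣ q ∣) ⊎ (p ≡ q)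
    _⁻¹         : ∀ {p} → Aut p → Aut p
    Aut-isGroup : ∀ p → IsGroup (_≈_ {p} {p}) _∘_ id _⁻¹

    -- Morphisms of rank difference 0 are excluded: they are automorphisms,
    -- whereas an empty composite is an identity.
    factor : ∀ {p q} (f : p ⇒ q) → ∣ p ∣ < ∣ q ∣ → Σ[ c ∈ Chain p q ] f ≈ compose c

    free-source : ∀ {p q} → ∣ q ∣ ≡ suc ∣ p ∣ →
                  (f : p ⇒ q) (β : Aut p) → f ∘ β ≈ f → β ≈ id
    free-target : ∀ {p q} → ∣ q ∣ ≡ suc ∣ p ∣ →
                  (f : p ⇒ q) (α : Aut q) → α ∘ f ≈ f → α ≈ id

record UpdownCategory (ℓ : Level) : Set (lsuc ℓ) where
  field
    raw      : RawRankedCategory ℓ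
    isUpdown : IsUpdown raw
  open RawRankedCategory raw public
  open IsUpdown isUpdown public

Univalent : ∀ {ℓ} → UpdownCategory ℓ → Set ℓ
Univalent C = ∀ p (f : Aut p) → f ≈ id
  where open UpdownCategory C

record IsUpdownMorphism {ℓ} (C D : UpdownCategory ℓ)
         (F : RawFunctor (UpdownCategory.category C) (UpdownCategory.category D)) :
         Set ℓ where
  private
    module C = UpdownCategory C
    module D = UpdownCategory D
  open RawFunctor F

  -- The coproduct of Hom(p,q′) over {q′ : F(q′) = F(q)}.
  ∐Hom : C.Obj → C.Obj → Set ℓ
  ∐Hom p q = Σ[ q′ ∈ C.Obj ] (F₀ q′ ≡ F₀ q) × p C.⇒ q′

  -- Equality in the coproduct of the quotients of Hom(p,q′) by _~_.
  ∐Rel : (∀ {p q} → Rel (p C.⇒ q) ℓ) → ∀ {p q} → Rel (∐Hom p q) ℓ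
  ∐Rel _~_ {p} (q′ , _ , f) (q″ , _ , g) = Σ[ e ∈ q′ ≡ q″ ] (subst (p C.⇒_) e f ~ g)

  induced : ∀ {p q} → ∐Hom p q → F₀ p D.⇒ F₀ q
  induced {p} (_ , e , f) = subst (F₀ p D.⇒_) e (F₁ f)

  field
    isFunctor    : IsFunctor F
    rank-pres    : ∀ p → D.∣ F₀ p ∣ ≡ C.∣ p ∣
    Aut-inj      : ∀ p → Injective C._≈_ D._≈_ (F₁ {p} {p})
    /source-inj  : ∀ p q → C.∣ q ∣ ≡ suc C.∣ p ∣ →
                   Injective (∐Rel C._≈/source_ {p} {q}) D._≈/source_ induced
    /target-inj  : ∀ p q → C.∣ q ∣ ≡ suc C.∣ p ∣ →
                   Injective (∐Rel C._≈/target_ {p} {q}) D._≈/target_ induced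
  open IsFunctor isFunctor public

record UpdownMorphism {ℓ} (C D : UpdownCategory ℓ) : Set ℓ where
  field
    raw        : RawFunctor (UpdownCategory.category C) (UpdownCategory.category D)
    isMorphism : IsUpdownMorphism C D raw
  open RawFunctor raw public
  open IsUpdownMorphism isMorphism public

idU : ∀ {ℓ} {C : UpdownCategory ℓ} → UpdownMorphism C C
idU {C = C} = record
  { raw = idF
  ; isMorphism = record
    { isFunctor   = record
      { resp-≈       = λ f≈g → f≈g
      ; identity     = C.Eq.refl
      ; homomorphism = λ _ _ → C.Eq.refl
      }
    ; rank-pres   = λ _ → refl
    ; Aut-inj     = λ _ f≈g → f≈g
    ; /source-inj = λ { _ _ _ {_ , refl , _} {_ , refl , _} f~g → refl , f~g }
    ; /target-inj = λ { _ _ _ {_ , refl , _} {_ , refl , _} f~g → refl , f~g }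
    }
  }
  where module C = UpdownCategory C

module _ {ℓ} {C D E : UpdownCategory ℓ} where
  private
    module C = UpdownCategory C
    module D = UpdownCategory D
    module E = UpdownCategory E

  infixr 9 _∘U_

  _∘U_ : UpdownMorphism D E → UpdownMorphism C D → UpdownMorphism C E
  G ∘U F = record
    { raw = G.raw ∘F F.raw
    ; isMorphism = record
      { isFunctor   = record
        { resp-≈       = λ f≈g → G.resp-≈ (F.resp-≈ f≈g)
        ; identity     = E.Eq.trans (G.resp-≈ F.identity) G.identity
        ; homomorphism = λ g f →
            E.Eq.trans (G.resp-≈ (F.homomorphism g f)) (G.homomorphism (F.F₁ g) (F.F₁ f))
        }
      ; rank-pres   = GF-rank
      ; Aut-inj     = λ p GFf≈GFg → F.Aut-inj p (G.Aut-inj (F.F₀ p) GFf≈GFg)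
      ; /source-inj = λ { p q r {q′ , e , f} {q″ , e′ , g} GFf~GFg →
          let e″ , Ff~Fg = G./source-inj (F.F₀ p) (F.F₀ q) (F-rank p q r)
                             {F.F₀ q′ , e , F.F₁ f} {F.F₀ q″ , e′ , F.F₁ g} GFf~GFg
          in F./source-inj p q″ (fibre-rank p q q″ r e′)
               {q′ , e″ , f} {q″ , refl , g} Ff~Fg }
      ; /target-inj = λ { p q r {q′ , e , f} {q″ , e′ , g} GFf~GFg →
          let e″ , Ff~Fg = G./target-inj (F.F₀ p) (F.F₀ q) (F-rank p q r)
                             {F.F₀ q′ , e , F.F₁ f} {F.F₀ q″ , e′ , F.F₁ g} GFf~GFg
          in F./target-inj p q″ (fibre-rank p q q″ r e′)
               {q′ , e″ , f} {q″ , refl , g} Ff~Fg }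
      }
    }
    where
    module F = UpdownMorphism F
    module G = UpdownMorphism G

    GF-rank : ∀ p → E.∣ G.F₀ (F.F₀ p) ∣ ≡ C.∣ p ∣
    GF-rank p = trans (G.rank-pres (F.F₀ p)) (F.rank-pres p)

    F-rank : ∀ p q → C.∣ q ∣ ≡ suc C.∣ p ∣ → D.∣ F.F₀ q ∣ ≡ suc D.∣ F.F₀ p ∣
    F-rank p q r = trans (F.rank-pres q) (trans r (cong suc (sym (F.rank-pres p))))

    fibre-rank : ∀ p q q″ → C.∣ q ∣ ≡ suc C.∣ p ∣ → G.F₀ (F.F₀ q″) ≡ G.F₀ (F.F₀ q) →
                 C.∣ q″ ∣ ≡ suc C.∣ p ∣
    fibre-rank p q q″ r e =
      trans (sym (GF-rank q″)) (trans (cong E.∣_∣ e) (trans (GF-rank q) r))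

module _ {o h e} (D : Category o h e) where
  open Category D

  subst₂-sym : ∀ {p p′ q q′} (e₁ : p ≡ p′) (e₂ : q ≡ q′) {f : p ⇒ q} {g : p′ ⇒ q′} →
               subst₂ _⇒_ e₁ e₂ f ≈ g → subst₂ _⇒_ (sym e₁) (sym e₂) g ≈ f
  subst₂-sym refl refl = Eq.sym

  subst₂-trans : ∀ {p p′ p″ q q′ q″} (e₁ : p ≡ p′) (e₁′ : p′ ≡ p″)
                   (e₂ : q ≡ q′) (e₂′ : q′ ≡ q″)
                   {f : p ⇒ q} {g : p′ ⇒ q′} {h : p″ ⇒ q″} →
                 subst₂ _⇒_ e₁ e₂ f ≈ g → subst₂ _⇒_ e₁′ e₂′ g ≈ h →
                 subst₂ _⇒_ (trans e₁ e₁′) (trans e₂ e₂′) f ≈ h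
  subst₂-trans refl refl refl refl = Eq.trans

  module _ {o′ h′ e′} {C : RawCategory o′ h′ e′} {G : RawFunctor C raw} where
    private
      module C = RawCategory C
      module G = RawFunctor G

    subst₂-cong : IsFunctor G →
                  ∀ {p p′ q q′} (e₁ : p ≡ p′) (e₂ : q ≡ q′) {f : p C.⇒ q} {g : p′ C.⇒ q′} →
                  subst₂ C._⇒_ e₁ e₂ f C.≈ g →
                  subst₂ _⇒_ (cong G.F₀ e₁) (cong G.F₀ e₂) (G.F₁ f) ≈ G.F₁ g
    subst₂-cong G-isFunctor refl refl = IsFunctor.resp-≈ G-isFunctor

𝔘 : ∀ ℓ → Category (lsuc ℓ) ℓ ℓ
𝔘 ℓ = record
  { raw = record
    { Obj = UpdownCategory ℓ
    ; _⇒_ = UpdownMorphism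
    ; _≈_ = λ F G → UpdownMorphism.raw F ≋ UpdownMorphism.raw G
    ; id  = idU
    ; _∘_ = _∘U_
    }
  ; isCategory = record
    { equiv     = λ {C} {D} → record
      { refl = ≋-refl C D ; sym = ≋-sym C D ; trans = ≋-trans C D }
    ; ∘-resp-≈  = λ {_} {_} {_} {G} {G′} {F} {F′} → ≋-∘ F F′ G G′
    ; identityˡ = λ {C} {D} _ → ≋-refl C D
    ; identityʳ = λ {C} {D} _ → ≋-refl C D
    ; assoc     = λ {C} {_} {_} {D} _ _ _ → ≋-refl C D
    }
  }
  where
  cat : UpdownCategory ℓ → Category ℓ ℓ ℓ
  cat C = record { isCategory = UpdownCategory.isCategory C }

  module _ (C D : UpdownCategory ℓ) where
    private
      RawF : Set ℓ
      RawF = RawFunctor (UpdownCategory.category C) (UpdownCategory.category D)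

    ≋-refl : {F : RawF} → F ≋ F
    ≋-refl = record { eq₀ = λ _ → refl ; eq₁ = λ _ → UpdownCategory.Eq.refl D }

    ≋-sym : {F G : RawF} → F ≋ G → G ≋ F
    ≋-sym F≋G = record
      { eq₀ = λ p → sym (eq₀ p)
      ; eq₁ = λ {p} {q} f → subst₂-sym (cat D) (eq₀ p) (eq₀ q) (eq₁ f)
      }
      where open _≋_ F≋G

    ≋-trans : {F G H : RawF} → F ≋ G → G ≋ H → F ≋ H
    ≋-trans F≋G G≋H = record
      { eq₀ = λ p → trans (FG.eq₀ p) (GH.eq₀ p)
      ; eq₁ = λ {p} {q} f → subst₂-trans (cat D) (FG.eq₀ p) (GH.eq₀ p)
                              (FG.eq₀ q) (GH.eq₀ q) (FG.eq₁ f) (GH.eq₁ f)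
      }
      where
      module FG = _≋_ F≋G
      module GH = _≋_ G≋H

  ≋-∘ : {C D E : UpdownCategory ℓ} (F F′ : UpdownMorphism C D) (G G′ : UpdownMorphism D E) →
        UpdownMorphism.raw G ≋ UpdownMorphism.raw G′ →
        UpdownMorphism.raw F ≋ UpdownMorphism.raw F′ →
        UpdownMorphism.raw (G ∘U F) ≋ UpdownMorphism.raw (G′ ∘U F′)
  ≋-∘ {E = E} F F′ G G′ G≋G′ F≋F′ = record
    { eq₀ = λ p → trans (cong G.F₀ (FF′.eq₀ p)) (GG′.eq₀ (F′.F₀ p))
    ; eq₁ = λ {p} {q} f →
        subst₂-trans (cat E) (cong G.F₀ (FF′.eq₀ p)) (GG′.eq₀ (F′.F₀ p))
          (cong G.F₀ (FF′.eq₀ q)) (GG′.eq₀ (F′.F₀ q))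
          (subst₂-cong (cat E) G.isFunctor (FF′.eq₀ p) (FF′.eq₀ q) (FF′.eq₁ f))
          (GG′.eq₁ (F′.F₁ f))
    }
    where
    module F′  = UpdownMorphism F′
    module G   = UpdownMorphism G
    module FF′ = _≋_ F≋F′
    module GG′ = _≋_ G≋G′

𝔘𝔘 : ∀ ℓ → Category (lsuc ℓ) ℓ ℓ
𝔘𝔘 ℓ = FullSubcategory (𝔘 ℓ) Univalent

module _ {ℓ} (C : RawRankedCategory ℓ) where
  open RawRankedCategory C

  data Arrow (p q : Obj) : Set ℓ where
    unit  : p ≡ q → Arrow p q
    class : ∣ p ∣ < ∣ q ∣ → p ⇒ q → Arrow p q

-- The objects and ranks of C, with only the identity from p to p, and the
-- quotient of Hom(p,q) by the equivalence relation generated by _~_ when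
-- ∣ p ∣ < ∣ q ∣. Arrow p p holds just the identity, rather than Aut(p) with all
-- elements identified: in C, composing a morphism with an automorphism can
-- change its class.
module Quotient {ℓ} (C : RawRankedCategory ℓ)
                (_~_ : ∀ {p q} → Rel (RawRankedCategory._⇒_ C p q) ℓ) where
  open RawRankedCategory C

  data _≈ᵃ_ {p q : Obj} : Rel (Arrow C p q) ℓ where
    unit  : ∀ {e e′} → unit e ≈ᵃ unit e′
    class : ∀ {l l′ f g} → EqClosure _~_ f g → class l f ≈ᵃ class l′ g

  _∘ᵃ_ : ∀ {p q r} → Arrow C q r → Arrow C p q → Arrow C p r
  unit refl ∘ᵃ f          = f
  class l g ∘ᵃ unit refl  = class l g
  class l g ∘ᵃ class l′ f = class (<-trans l′ l) (g ∘ f)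

  rankᵃ : ∀ {p q} → Arrow C p q → ∣ p ∣ ≤ ∣ q ∣
  rankᵃ (unit refl) = ≤-refl
  rankᵃ (class l _) = <⇒≤ l

  quotient : RawRankedCategory ℓ
  quotient = record
    { category = record
      { Obj = Obj
      ; _⇒_ = Arrow C
      ; _≈_ = _≈ᵃ_
      ; id  = unit refl
      ; _∘_ = _∘ᵃ_
      }
    ; rank = record { F₀ = ∣_∣ ; F₁ = rankᵃ }
    }

module _ {ℓ} (C : UpdownCategory ℓ) where
  open UpdownCategory C

  -- The explicit ≈ make these relations on hom-sets independent of
  -- representatives; as every morphism that raises rank factors, the
  -- equivalence relations they generate there contain _≈_.
  _~↑_ _~↓_ : ∀ {p q} → Rel (p ⇒ q) ℓ
  _~↑_ {p} {q} f g = Σ[ c ∈ Chain p q ] Σ[ αs ∈ TargetAuts c ]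
                     (f ≈ compose c) × (g ≈ compose-target c αs)
  _~↓_ {p} {q} f g = Σ[ c ∈ Chain p q ] Σ[ βs ∈ SourceAuts c ]
                     (f ≈ compose c) × (g ≈ compose-source c βs)

infix 10 _↑ _↓

_↑ _↓ : ∀ {ℓ} → UpdownCategory ℓ → RawRankedCategory ℓ
C ↑ = Quotient.quotient (UpdownCategory.raw C) (_~↑_ C)
C ↓ = Quotient.quotient (UpdownCategory.raw C) (_~↓_ C)

module _ {ℓ} {C D : UpdownCategory ℓ} (F : UpdownMorphism C D) where
  private
    module C = UpdownCategory C
    module D = UpdownCategory D
  open UpdownMorphism F

  mapᵃ : ∀ {p q} → Arrow C.raw p q → Arrow D.raw (F₀ p) (F₀ q)
  mapᵃ         (unit e)    = unit (cong F₀ e)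
  mapᵃ {p} {q} (class l f) =
    class (subst₂ _<_ (sym (rank-pres p)) (sym (rank-pres q)) l) (F₁ f)

  infix 10 _↑₁ _↓₁

  _↑₁ : RawFunctor (RawRankedCategory.category (C ↑)) (RawRankedCategory.category (D ↑))
  _↑₁ = record { F₀ = F₀ ; F₁ = mapᵃ }

  _↓₁ : RawFunctor (RawRankedCategory.category (C ↓)) (RawRankedCategory.category (D ↓))
  _↓₁ = record { F₀ = F₀ ; F₁ = mapᵃ }

record GivenBy {ℓ} (T : Functor (𝔘 ℓ) (𝔘𝔘 ℓ))
               (ob  : UpdownCategory ℓ → RawRankedCategory ℓ)
               (mor : ∀ {C D} → UpdownMorphism C D →
                      RawFunctor (RawRankedCategory.category (ob C))
                                 (RawRankedCategory.category (ob D))) :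
               Set (lsuc ℓ) where
  private
    module T = Functor T
  field
    on-objects   : ∀ C → UpdownCategory.raw (proj₁ (T.F₀ C)) ≡ ob C
    on-morphisms : ∀ {C D} (F : UpdownMorphism C D) →
      subst₂ (λ X Y → RawFunctor (RawRankedCategory.category X) (RawRankedCategory.category Y))
             (on-objects C) (on-objects D) (UpdownMorphism.raw (T.F₁ F))
      ≋ mor F

{-# OPTIONS --safe #-}
module Submission where

-- Call two morphisms stepwise equivalent if they factor into adjacent-rank maps through the same
-- objects, with corresponding factors equal in Hom/Aut(target) (for C ↑) or in Hom/Aut(source)
-- (for C ↓). This relation is compatible with composition and decidable by recursion on the rank
-- difference, so the equivalence relation it generates has finitely many classes on each Hom; the
-- remaining axioms hold because automorphisms become trivial. Between adjacent ranks the classes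
-- are exactly Hom/Aut(target), respectively Hom/Aut(source). Hence for the image of F both
-- injectivity conditions, which now coincide, reduce to one of the two conditions on F.

open import Level using (Level; _⊔_) renaming (suc to lsuc)
open import Algebra.Structures using (IsGroup)
open import Data.Empty using (⊥; ⊥-elim)
open import Data.Fin.Base using (Fin; zero; punchIn; punchOut)
open import Data.Fin.Properties
  using (any?; punchInᵢ≢i; punchIn-punchOut; punchOut-punchIn; punchOut-cong)
  renaming (_≟_ to _≟ᶠ_)
open import Data.Nat.Base using (ℕ; zero; suc; _+_; _<_)
open import Data.Nat.Properties
  using (_≟_; _<?_; ≡-irrelevant; +-comm; ≤-irrelevant; ≤-reflexive; <-irrefl; <-trans; +-suc;
         suc-injective; m≢1+n+m; m≤n⇒∃[o]m+o≡n; n≢0⇒n>0)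
open import Data.Product.Base using (Σ-syntax; ∃; ∃-syntax; _×_; _,_; proj₁; proj₂)
open import Data.Sum.Base using (inj₁; inj₂)
open import Function.Base using (case_of_)
open import Function.Bundles using (Inverse)
open import Function.Definitions using (Injective)
open import Relation.Binary.Bundles using (Setoid)
open import Relation.Binary.Core using (Rel)
open import Relation.Binary.Structures using (IsEquivalence)
import Relation.Binary.Construct.Closure.Equivalence as EqC
open EqC using (EqClosure)
open import Relation.Binary.Construct.Closure.Transitive using ([_]; _∷_)
import Relation.Binary.Definitions as B
open import Axiom.UniquenessOfIdentityProofs using (module Decidable⇒UIP)
open import Relation.Binary.PropositionalEquality as ≡
  using (_≡_; _≢_; refl; sym; trans; cong; subst; subst₂)
open import Relation.Nullary using (Dec; yes; no; contradiction)
open import Relation.Nullary.Decidable using (map′; _×-dec_; ¬?; decidable-stable)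
open import Relation.Unary using (Decidable)
open import Defs

-- Finite setoids and their quotients by generated equivalence relations

Finite : ∀ {a ℓ} → Setoid a ℓ → Set (a ⊔ ℓ)
Finite S = ∃[ k ] Inverse S (≡.setoid (Fin k))

module FiniteSetoid {a ℓ} (S : Setoid a ℓ) (finite : Finite S) where
  open Setoid S renaming (Carrier to A; refl to ≈-refl; sym to ≈-sym; trans to ≈-trans)
  open Inverse (proj₂ finite)

  -- Only the representatives `from i` are searched; `resp` moves an arbitrary witness `x` to
  -- `from (to x)`.
  ∃? : ∀ {p} {P : A → Set p} → (∀ {x y} → x ≈ y → P x → P y) → Decidable P → Dec (∃ P)
  ∃? resp P? = map′
    (λ { (i , Px) → from i , Px })
    (λ { (x , Px) → to x , resp (≈-sym (strictlyInverseʳ x)) Px })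
    (any? (λ i → P? (from i)))

  infix 4 _≈?_
  _≈?_ : B.Decidable _≈_
  x ≈? y = map′ (λ e → ≈-trans (≈-sym (strictlyInverseʳ x)) (≈-trans (from-cong e) (strictlyInverseʳ y)))
                to-cong (to x ≟ᶠ to y)

  -- Classes related by _∼_ are merged one pair at a time; the number of classes decreases.
  module _ {r} {_∼_ : Rel A r} (_∼?_ : B.Decidable _∼_) (≈⇒∼ : ∀ {x y} → x ≈ y → x ∼ y)
           (∼-resp-≈ : ∀ {x x′ y y′} → x ≈ x′ → y ≈ y′ → x ∼ y → x′ ∼ y′) where

    -- A partition into `k` classes that may still be too fine: elements of one class are linked by
    -- `EqClosure _∼_`, but linked elements may lie in different classes.
    record Classifier (k : ℕ) : Set (a ⊔ ℓ ⊔ r) where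
      field
        class-of        : A → Fin k
        class-of-cong   : ∀ {x y} → x ≈ y → class-of x ≡ class-of y
        representative  : Fin k → A
        class-of-repr   : ∀ i → class-of (representative i) ≡ i
        repr-of-class   : ∀ x → EqClosure _∼_ x (representative (class-of x))

    merge : ∀ {k} (c : Classifier (suc k)) (let open Classifier c) →
            ∀ {x y} → x ∼ y → class-of x ≢ class-of y → Classifier k
    merge {k} c {x} {y} x∼y i≢j = record
      { class-of       = λ z → collapse (class-of z)
      ; class-of-cong  = λ e → cong collapse (class-of-cong e)
      ; representative = λ m → representative (punchIn i m)
      ; class-of-repr  = λ m → trans (cong collapse (class-of-repr (punchIn i m))) (collapse-punchIn m)
      ; repr-of-class  = λ z → EqC.transitive _ (repr-of-class z) (repr-collapse (class-of z))
      }
      where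
      open Classifier c
      i j : Fin (suc k)
      i = class-of x
      j = class-of y

      collapse : Fin (suc k) → Fin k
      collapse m with i ≟ᶠ m
      -- The index `i` is deleted: the class of `x` joins that of `y`, and every other class is only
      -- renumbered.
      ... | yes _   = punchOut i≢j
      ... | no  i≢m = punchOut i≢m

      collapse-punchIn : ∀ m → collapse (punchIn i m) ≡ m
      collapse-punchIn m with i ≟ᶠ punchIn i m
      ... | yes e   = contradiction (sym e) (punchInᵢ≢i i m)
      ... | no  i≢m = trans (punchOut-cong i refl) (punchOut-punchIn i)

      repr-collapse : ∀ m → EqClosure _∼_ (representative m) (representative (punchIn i (collapse m)))
      repr-collapse m with i ≟ᶠ m
      ... | no  i≢m  rewrite punchIn-punchOut i≢m = EqC.reflexive _
      ... | yes refl rewrite punchIn-punchOut i≢j =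
        EqC.transitive _ (EqC.symmetric _ (repr-of-class x))
          (EqC.transitive _ (EqC.return x∼y) (repr-of-class y))

    unmerged? : ∀ {k} (c : Classifier k) (let open Classifier c) →
                Dec (∃[ x ] ∃[ y ] (x ∼ y × class-of x ≢ class-of y))
    unmerged? c =
      ∃? (λ { x≈x′ (y , x∼y , ne) → y , ∼-resp-≈ x≈x′ ≈-refl x∼y ,
               λ e → ne (trans (class-of-cong x≈x′) e) })
         (λ x → ∃? (λ { y≈y′ (x∼y , ne) → ∼-resp-≈ ≈-refl y≈y′ x∼y ,
                         λ e → ne (trans e (sym (class-of-cong y≈y′))) })
                   (λ y → (x ∼? y) ×-dec ¬? (class-of x ≟ᶠ class-of y)))
      where open Classifier c

    -- Recursion on `k`: while some `∼`-related pair is separated, its classes are merged. Once no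
    -- such pair is left, `class-of` is constant along `EqClosure _∼_`, so the partition is the
    -- quotient.
    classifier⇒finite : ∀ {k} → Classifier k → Finite (EqC.setoid _∼_)
    classifier⇒finite {k} c with unmerged? c
    classifier⇒finite {zero}  c | yes (x , _) = case Classifier.class-of c x of λ ()
    classifier⇒finite {suc k} c | yes (_ , _ , x∼y , ne) = classifier⇒finite (merge c x∼y ne)
    classifier⇒finite {k}     c | no merged = k , record
      { to        = class-of
      ; from      = representative
      ; to-cong   = to-cong′
      ; from-cong = λ { refl → EqC.reflexive _ }
      ; inverse   = (λ {i} e → trans (to-cong′ e) (class-of-repr i))
                  , (λ { {x} refl → EqC.symmetric _ (repr-of-class x) })
      }
      where
      open Classifier c
      to-cong′ : ∀ {x y} → EqClosure _∼_ x y → class-of x ≡ class-of y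
      to-cong′ = EqC.gfold ≡.isEquivalence class-of
        (λ {x} {y} x∼y → decidable-stable (class-of x ≟ᶠ class-of y) (λ ne → merged (x , y , x∼y , ne)))

    EqClosure-finite : Finite (EqC.setoid _∼_)
    -- Merging starts from the classes of `_≈_`, enumerated by the given finiteness.
    EqClosure-finite = classifier⇒finite record
      { class-of       = to
      ; class-of-cong  = to-cong
      ; representative = from
      ; class-of-repr  = strictlyInverseˡ
      ; repr-of-class  = λ x → EqC.return (≈⇒∼ (≈-sym (strictlyInverseʳ x)))
      }

-- Decidability and automorphism quotients in an updown category

module UpdownProperties {ℓ} (C : UpdownCategory ℓ) where
  open UpdownCategory C
  open FiniteSetoid using (∃?)

  infix 4 _≟ᵒ_
  -- Objects of different ranks differ; those of one rank are compared in the finite set given by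
  -- (A1).
  _≟ᵒ_ : B.DecidableEquality Obj
  p ≟ᵒ q with ∣ p ∣ ≟ ∣ q ∣
  ... | no  ne = no λ p≡q → ne (cong ∣_∣ p≡q)
  ... | yes e  = map′ (cong proj₁) (λ { refl → cong (p ,_) (≡-irrelevant _ _) })
                      ((p , e) ≟ᶠⁱᵇʳᵉ (q , refl))
    where open FiniteSetoid (≡.setoid (Σ[ r ∈ Obj ] ∣ r ∣ ≡ ∣ q ∣)) (rank-finite ∣ q ∣)
            renaming (_≈?_ to _≟ᶠⁱᵇʳᵉ_)

  -- Hedberg's theorem. It is used to turn the proof inside a `unit` arrow into `refl`, the form on
  -- which `_∘ᵃ_` computes.
  Obj-UIP : ∀ {p q : Obj} (e e′ : p ≡ q) → e ≡ e′
  Obj-UIP = Decidable⇒UIP.≡-irrelevant _≟ᵒ_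

  ∃-rank? : ∀ n {P : Obj → Set ℓ} → (∀ r → ∣ r ∣ ≡ n → Dec (P r)) →
            Dec (∃[ r ] ∣ r ∣ ≡ n × P r)
  ∃-rank? n P? = map′ (λ { ((r , e) , Pr) → r , e , Pr }) (λ { (r , e , Pr) → (r , e) , Pr })
    (∃? (≡.setoid _) (rank-finite n) (λ { refl Pr → Pr }) (λ (r , e) → P? r e))

  ∃-hom? : ∀ {p q} {P : p ⇒ q → Set ℓ} → (∀ {f g} → f ≈ g → P f → P g) → Decidable P → Dec (∃ P)
  ∃-hom? {p} {q} = ∃? (hom-setoid p q) (hom-finite p q)

  infix 4 _≈?_
  _≈?_ : ∀ {p q} → B.Decidable (_≈_ {p} {q})
  _≈?_ {p} {q} = FiniteSetoid._≈?_ (hom-setoid p q) (hom-finite p q)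

  chain-rank : ∀ {p q} → Chain p q → ∣ p ∣ < ∣ q ∣
  chain-rank [ _ , r ]     = ≤-reflexive (sym r)
  chain-rank ((_ , r) ∷ c) = <-trans (≤-reflexive (sym r)) (chain-rank c)

  ∘-cong-outer : ∀ {p q r} {g g′ : q ⇒ r} {f : p ⇒ q} → g ≈ g′ → g ∘ f ≈ g′ ∘ f
  ∘-cong-outer e = ∘-resp-≈ e Eq.refl

  ∘-cong-inner : ∀ {p q r} {g : q ⇒ r} {f f′ : p ⇒ q} → f ≈ f′ → g ∘ f ≈ g ∘ f′
  ∘-cong-inner e = ∘-resp-≈ Eq.refl e

module _ {ℓ} (C : UpdownCategory ℓ) where
  open UpdownCategory C
  open UpdownProperties C

  ≈/source-isEquivalence : ∀ {p q} → IsEquivalence (_≈/source_ {p} {q})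
  ≈/source-isEquivalence {p} = record
    { refl  = λ {f} → id , identityʳ f
    ; sym   = λ { {f} {g} (β , fβ≈g) → β ⁻¹ ,
        Eq.trans (∘-cong-outer (Eq.sym fβ≈g))
          (Eq.trans (assoc f β (β ⁻¹)) (Eq.trans (∘-cong-inner (inverseʳ β)) (identityʳ f))) }
    ; trans = λ { {f} (β , fβ≈g) (γ , gγ≈h) → β ∘ γ ,
        Eq.trans (Eq.sym (assoc f β γ)) (Eq.trans (∘-cong-outer fβ≈g) gγ≈h) }
    }
    where open IsGroup (Aut-isGroup p) using (inverseʳ)

  ≈/target-isEquivalence : ∀ {p q} → IsEquivalence (_≈/target_ {p} {q})
  ≈/target-isEquivalence {q = q} = record
    { refl  = λ {f} → id , identityˡ f
    ; sym   = λ { {f} {g} (α , αf≈g) → α ⁻¹ ,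
        Eq.trans (∘-cong-inner (Eq.sym αf≈g))
          (Eq.trans (Eq.sym (assoc (α ⁻¹) α f)) (Eq.trans (∘-cong-outer (inverseˡ α)) (identityˡ f))) }
    ; trans = λ { {f} (α , αf≈g) (γ , γg≈h) → γ ∘ α ,
        Eq.trans (assoc γ α f) (Eq.trans (∘-cong-inner αf≈g) γg≈h) }
    }
    where open IsGroup (Aut-isGroup q) using (inverseˡ)

  ≈⇒≈/source : ∀ {p q} {f g : p ⇒ q} → f ≈ g → f ≈/source g
  ≈⇒≈/source {f = f} e = id , Eq.trans (identityʳ f) e

  ≈⇒≈/target : ∀ {p q} {f g : p ⇒ q} → f ≈ g → f ≈/target g
  ≈⇒≈/target {f = f} e = id , Eq.trans (identityˡ f) e

  ≈/source? : ∀ {p q} → B.Decidable (_≈/source_ {p} {q})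
  ≈/source? f g = ∃-hom? (λ e → Eq.trans (∘-cong-inner (Eq.sym e))) (λ β → f ∘ β ≈? g)

  ≈/target? : ∀ {p q} → B.Decidable (_≈/target_ {p} {q})
  ≈/target? f g = ∃-hom? (λ e → Eq.trans (∘-cong-outer (Eq.sym e))) (λ α → α ∘ f ≈? g)

-- Stepwise equivalence of morphisms

HomRel : ∀ {ℓ} → UpdownCategory ℓ → Set (lsuc ℓ)
HomRel {ℓ} C = ∀ {p q} → Rel (UpdownCategory._⇒_ C p q) ℓ

module _ {ℓ} (C : UpdownCategory ℓ) (_∼_ : HomRel C) where
  open UpdownCategory C

  -- A relation on each factor replaces the list of automorphisms along a chain, so that target and
  -- source automorphisms are treated at once. Transitivity is not claimed: two related pairs may
  -- factor their common morphism through different objects, which is why the generated equivalence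
  -- is taken later.
  data Stepwise {p q : Obj} (f g : p ⇒ q) : Set ℓ where
    step : ∣ q ∣ ≡ suc ∣ p ∣ → f ∼ g → Stepwise f g
    cons : ∀ {r} → ∣ r ∣ ≡ suc ∣ p ∣ → {f₁ g₁ : p ⇒ r} {f₂ g₂ : r ⇒ q} →
           f₁ ∼ g₁ → Stepwise f₂ g₂ → f ≈ f₂ ∘ f₁ → g ≈ g₂ ∘ g₁ → Stepwise f g

-- Instances: _∼_ is _≈/target_ when _~_ is _~↑_, and _≈/source_ when _~_ is _~↓_.
record StepCongruence {ℓ} (C : UpdownCategory ℓ) (_~_ : HomRel C) : Set (lsuc ℓ) where
  open UpdownCategory C
  field
    _∼_           : HomRel C
    isEquivalence : ∀ {p q} → IsEquivalence (_∼_ {p} {q})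
    ≈⇒∼           : ∀ {p q} {f g : p ⇒ q} → f ≈ g → f ∼ g
    _∼?_          : ∀ {p q} → B.Decidable (_∼_ {p} {q})
    ~⇒Stepwise    : ∀ {p q} {f g : p ⇒ q} → f ~ g → Stepwise C _∼_ f g
    Stepwise⇒~    : ∀ {p q} {f g : p ⇒ q} → Stepwise C _∼_ f g → f ~ g

module _ {ℓ} (C : UpdownCategory ℓ) where
  open UpdownCategory C
  open UpdownProperties C

  ↑-stepCongruence : StepCongruence C (_~↑_ C)
  ↑-stepCongruence = record
    { _∼_           = _≈/target_
    ; isEquivalence = ≈/target-isEquivalence C
    ; ≈⇒∼           = ≈⇒≈/target C
    ; _∼?_          = ≈/target? C
    ; ~⇒Stepwise    = λ { (c , αs , f≈ , g≈) → to c αs f≈ g≈ }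
    ; Stepwise⇒~    = from
    }
    where
    to : ∀ {p q} (c : Chain p q) (αs : TargetAuts c) {f g : p ⇒ q} →
         f ≈ compose c → g ≈ compose-target c αs → Stepwise C _≈/target_ f g
    to [ _ , r ]     α        f≈ g≈ = step r (α , Eq.trans (∘-cong-inner f≈) (Eq.sym g≈))
    to ((_ , r) ∷ c) (α , αs) f≈ g≈ = cons r (α , Eq.refl) (to c αs Eq.refl Eq.refl) f≈ g≈

    -- The chain is made of the factors of `f`; the automorphisms carry them to the factors of `g`.
    from : ∀ {p q} {f g : p ⇒ q} → Stepwise C _≈/target_ f g → _~↑_ C f g
    from {f = f} (step r (α , αf≈g)) = [ f , r ] , α , Eq.refl , Eq.sym αf≈g
    from (cons r {f₁ = f₁} (α , αf₁≈g₁) s f≈ g≈) with from s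
    ... | c , αs , f₂≈ , g₂≈ = (f₁ , r) ∷ c , (α , αs) ,
      Eq.trans f≈ (∘-cong-outer f₂≈) , Eq.trans g≈ (∘-resp-≈ g₂≈ (Eq.sym αf₁≈g₁))

  ↓-stepCongruence : StepCongruence C (_~↓_ C)
  ↓-stepCongruence = record
    { _∼_           = _≈/source_
    ; isEquivalence = ≈/source-isEquivalence C
    ; ≈⇒∼           = ≈⇒≈/source C
    ; _∼?_          = ≈/source? C
    ; ~⇒Stepwise    = λ { (c , βs , f≈ , g≈) → to c βs f≈ g≈ }
    ; Stepwise⇒~    = from
    }
    where
    to : ∀ {p q} (c : Chain p q) (βs : SourceAuts c) {f g : p ⇒ q} →
         f ≈ compose c → g ≈ compose-source c βs → Stepwise C _≈/source_ f g
    to [ _ , r ]     β        f≈ g≈ = step r (β , Eq.trans (∘-cong-outer f≈) (Eq.sym g≈))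
    to ((_ , r) ∷ c) (β , βs) f≈ g≈ = cons r (β , Eq.refl) (to c βs Eq.refl Eq.refl) f≈ g≈

    from : ∀ {p q} {f g : p ⇒ q} → Stepwise C _≈/source_ f g → _~↓_ C f g
    from {f = f} (step r (β , fβ≈g)) = [ f , r ] , β , Eq.refl , Eq.sym fβ≈g
    from (cons r {f₁ = f₁} (β , f₁β≈g₁) s f≈ g≈) with from s
    ... | c , βs , f₂≈ , g₂≈ = (f₁ , r) ∷ c , (β , βs) ,
      Eq.trans f≈ (∘-cong-outer f₂≈) , Eq.trans g≈ (∘-resp-≈ g₂≈ (Eq.sym f₁β≈g₁))

-- The quotient as a univalent updown category

module StepQuotient {ℓ} (C : UpdownCategory ℓ) {_~_ : HomRel C} (S : StepCongruence C _~_) where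
  open UpdownCategory C
  open UpdownProperties C
  open StepCongruence S
  private
    module S {p q} = IsEquivalence (isEquivalence {p} {q})
    infix 4 _≈ˢ_
    _≈ˢ_ : HomRel C
    _≈ˢ_ = Stepwise C _∼_

  Stepwise-rank : ∀ {p q} {f g : p ⇒ q} → f ≈ˢ g → ∣ p ∣ < ∣ q ∣
  Stepwise-rank (step r _)         = ≤-reflexive (sym r)
  Stepwise-rank (cons r _ f∼g _ _) = <-trans (≤-reflexive (sym r)) (Stepwise-rank f∼g)

  Stepwise-resp-≈ : ∀ {p q} {f f′ g g′ : p ⇒ q} → f ≈ f′ → g ≈ g′ → f ≈ˢ g → f′ ≈ˢ g′
  Stepwise-resp-≈ e e′ (step r s)         = step r (S.trans (≈⇒∼ (Eq.sym e)) (S.trans s (≈⇒∼ e′)))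
  Stepwise-resp-≈ e e′ (cons r s t f≈ g≈) =
    cons r s t (Eq.trans (Eq.sym e) f≈) (Eq.trans (Eq.sym e′) g≈)

  compose-refl : ∀ {p q} (c : Chain p q) → compose c ≈ˢ compose c
  compose-refl [ _ , r ]     = step r S.refl
  compose-refl ((_ , r) ∷ c) = cons r S.refl (compose-refl c) Eq.refl Eq.refl

  -- By (A4) `f` is a composite of adjacent-rank maps, each related to itself. Only morphisms that
  -- raise rank have such a factorisation.
  ≈⇒Stepwise : ∀ {p q} {f g : p ⇒ q} → ∣ p ∣ < ∣ q ∣ → f ≈ g → f ≈ˢ g
  ≈⇒Stepwise {f = f} l f≈g with factor f l
  ... | c , f≈c = Stepwise-resp-≈ (Eq.sym f≈c) (Eq.trans (Eq.sym f≈c) f≈g) (compose-refl c)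

  -- Recursion on the inner pair: its steps are put in front of those of the outer pair, regrouped
  -- by associativity.
  Stepwise-∘ : ∀ {p q r} {f f′ : p ⇒ q} {g g′ : q ⇒ r} → g ≈ˢ g′ → f ≈ˢ f′ → g ∘ f ≈ˢ g′ ∘ f′
  Stepwise-∘ t (step r s)          = cons r s t Eq.refl Eq.refl
  Stepwise-∘ t (cons r s u f≈ f′≈) =
    cons r s (Stepwise-∘ t u)
      (Eq.trans (∘-cong-inner f≈) (Eq.sym (assoc _ _ _)))
      (Eq.trans (∘-cong-inner f′≈) (Eq.sym (assoc _ _ _)))

  -- A `cons` would reach the rank of `q` after its first step, while the remaining steps still have
  -- to raise the rank.
  Stepwise-adjacent : ∀ {p q} {f g : p ⇒ q} → ∣ q ∣ ≡ suc ∣ p ∣ → f ≈ˢ g → f ∼ g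
  Stepwise-adjacent _ (step _ s)         = s
  Stepwise-adjacent e (cons r _ t _ _) =
    ⊥-elim (<-irrefl (trans r (sym e)) (Stepwise-rank t))

  -- Here `n` is one less than the rank difference. For `suc n` a finite search runs over the middle
  -- object of rank `suc ∣ p ∣` and the four factors; the side arguments show that each condition
  -- respects `_≈_`.
  Stepwise-dec : ∀ n {p q} → ∣ q ∣ ≡ suc n + ∣ p ∣ → (f g : p ⇒ q) → Dec (f ≈ˢ g)
  Stepwise-dec zero          e f g = map′ (step e) (Stepwise-adjacent e) (f ∼? g)
  Stepwise-dec (suc n) {p} {q} e f g = map′
    join split
    (∃-rank? (suc ∣ p ∣) λ r r-rank →
      ∃-hom? {P = λ f₁ → Σ[ g₁ ∈ p ⇒ r ] Σ[ f₂ ∈ r ⇒ q ] Σ[ g₂ ∈ r ⇒ q ] Split f₁ g₁ f₂ g₂}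
        (λ { e (_ , _ , _ , s , t , f≈ , g≈) →
          _ , _ , _ , S.trans (≈⇒∼ (Eq.sym e)) s , t , Eq.trans f≈ (∘-cong-inner e) , g≈ }) λ f₁ →
      ∃-hom? {P = λ g₁ → Σ[ f₂ ∈ r ⇒ q ] Σ[ g₂ ∈ r ⇒ q ] Split f₁ g₁ f₂ g₂}
        (λ { e (_ , _ , s , t , f≈ , g≈) →
          _ , _ , S.trans s (≈⇒∼ e) , t , f≈ , Eq.trans g≈ (∘-cong-inner e) }) λ g₁ →
      ∃-hom? {P = λ f₂ → Σ[ g₂ ∈ r ⇒ q ] Split f₁ g₁ f₂ g₂}
        (λ { e (_ , s , t , f≈ , g≈) →
          _ , s , Stepwise-resp-≈ e Eq.refl t , Eq.trans f≈ (∘-cong-outer e) , g≈ }) λ f₂ →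
      ∃-hom? {P = Split f₁ g₁ f₂}
        (λ { e (s , t , f≈ , g≈) →
          s , Stepwise-resp-≈ Eq.refl e t , f≈ , Eq.trans g≈ (∘-cong-outer e) }) λ g₂ →
      (f₁ ∼? g₁) ×-dec Stepwise-dec n (rank-split r r-rank) f₂ g₂ ×-dec (f ≈? f₂ ∘ f₁) ×-dec (g ≈? g₂ ∘ g₁))
    where
    Split : ∀ {r} → p ⇒ r → p ⇒ r → r ⇒ q → r ⇒ q → Set ℓ
    Split f₁ g₁ f₂ g₂ = f₁ ∼ g₁ × f₂ ≈ˢ g₂ × f ≈ f₂ ∘ f₁ × g ≈ g₂ ∘ g₁

    join : (Σ[ r ∈ Obj ] ∣ r ∣ ≡ suc ∣ p ∣ ×
              (Σ[ f₁ ∈ p ⇒ r ] Σ[ g₁ ∈ p ⇒ r ] Σ[ f₂ ∈ r ⇒ q ] Σ[ g₂ ∈ r ⇒ q ] Split f₁ g₁ f₂ g₂)) →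
           f ≈ˢ g
    join (_ , r , _ , _ , _ , _ , s , t , f≈ , g≈) = cons r s t f≈ g≈

    split : f ≈ˢ g → Σ[ r ∈ Obj ] ∣ r ∣ ≡ suc ∣ p ∣ ×
              (Σ[ f₁ ∈ p ⇒ r ] Σ[ g₁ ∈ p ⇒ r ] Σ[ f₂ ∈ r ⇒ q ] Σ[ g₂ ∈ r ⇒ q ] Split f₁ g₁ f₂ g₂)
    -- A single step is impossible, since the rank difference is at least two.
    split (step r _)         = contradiction (suc-injective (trans (sym r) e)) (m≢1+n+m _)
    split (cons r s t f≈ g≈) = _ , r , _ , _ , _ , _ , s , t , f≈ , g≈

    rank-split : ∀ r → ∣ r ∣ ≡ suc ∣ p ∣ → ∣ q ∣ ≡ suc n + ∣ r ∣
    rank-split r r-rank = trans e (trans (cong suc (sym (+-suc n ∣ p ∣))) (cong (suc n +_) (sym r-rank)))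

  ~-dec : ∀ {p q} → ∣ p ∣ < ∣ q ∣ → (f g : p ⇒ q) → Dec (f ~ g)
  ~-dec {p} l f g with m≤n⇒∃[o]m+o≡n l
  ... | n , e = map′ Stepwise⇒~ ~⇒Stepwise
                  (Stepwise-dec n (trans (sym e) (cong suc (+-comm ∣ p ∣ n))) f g)

  ≈⇒~ : ∀ {p q} {f g : p ⇒ q} → ∣ p ∣ < ∣ q ∣ → f ≈ g → f ~ g
  ≈⇒~ l e = Stepwise⇒~ (≈⇒Stepwise l e)

  ~-resp-≈ : ∀ {p q} {f f′ g g′ : p ⇒ q} → f ≈ f′ → g ≈ g′ → f ~ g → f′ ~ g′
  ~-resp-≈ e e′ s = Stepwise⇒~ (Stepwise-resp-≈ e e′ (~⇒Stepwise s))

  -- One side varies at a time, along a path of generators. The fixed factor is related to itself by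
  -- `≈⇒Stepwise`, which is where the rank inequalities enter.
  EqClosure-∘ : ∀ {p q r} {f f′ : p ⇒ q} {g g′ : q ⇒ r} → ∣ p ∣ < ∣ q ∣ → ∣ q ∣ < ∣ r ∣ →
                EqClosure _~_ g g′ → EqClosure _~_ f f′ → EqClosure _~_ (g ∘ f) (g′ ∘ f′)
  EqClosure-∘ {f = f} {g′ = g′} l l′ gs fs = EqC.transitive _
    (EqC.gmap (_∘ f) (λ s → Stepwise⇒~ (Stepwise-∘ (~⇒Stepwise s) (≈⇒Stepwise l Eq.refl))) gs)
    (EqC.gmap (g′ ∘_) (λ s → Stepwise⇒~ (Stepwise-∘ (≈⇒Stepwise l′ Eq.refl) (~⇒Stepwise s))) fs)

  -- Between adjacent ranks the generators already lie in the equivalence relation `_∼_`, so closing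
  -- them adds nothing beyond it.
  EqClosure-adjacent : ∀ {p q} {f g : p ⇒ q} → ∣ q ∣ ≡ suc ∣ p ∣ → EqClosure _~_ f g → f ∼ g
  EqClosure-adjacent e = EqC.fold isEquivalence (λ s → Stepwise-adjacent e (~⇒Stepwise s))

  open Quotient raw _~_

  ≈ᵃ-isEquivalence : ∀ {p q} → IsEquivalence (_≈ᵃ_ {p} {q})
  ≈ᵃ-isEquivalence = record { refl = ≈ᵃ-refl ; sym = ≈ᵃ-sym ; trans = ≈ᵃ-trans }
    where
    ≈ᵃ-refl : ∀ {p q} {f : Arrow raw p q} → f ≈ᵃ f
    ≈ᵃ-refl {f = unit _}    = unit
    ≈ᵃ-refl {f = class _ _} = class (EqC.reflexive _)

    ≈ᵃ-sym : ∀ {p q} {f g : Arrow raw p q} → f ≈ᵃ g → g ≈ᵃ f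
    ≈ᵃ-sym unit      = unit
    ≈ᵃ-sym (class s) = class (EqC.symmetric _ s)

    ≈ᵃ-trans : ∀ {p q} {f g h : Arrow raw p q} → f ≈ᵃ g → g ≈ᵃ h → f ≈ᵃ h
    ≈ᵃ-trans unit      unit      = unit
    ≈ᵃ-trans (class s) (class t) = class (EqC.transitive _ s t)

  class-≈ : ∀ {p q} {l l′ : ∣ p ∣ < ∣ q ∣} {f g : p ⇒ q} → f ≈ g → class l f ≈ᵃ class l′ g
  class-≈ {l = l} e = class (EqC.return (≈⇒~ l e))

  ∘ᵃ-resp-≈ᵃ : ∀ {p q r} {g g′ : Arrow raw q r} {f f′ : Arrow raw p q} →
               g ≈ᵃ g′ → f ≈ᵃ f′ → (g ∘ᵃ f) ≈ᵃ (g′ ∘ᵃ f′)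
  ∘ᵃ-resp-≈ᵃ (unit {refl} {e′}) s with refl ← Obj-UIP refl e′ = s
  ∘ᵃ-resp-≈ᵃ (class s) (unit {refl} {e′}) with refl ← Obj-UIP refl e′ = class s
  ∘ᵃ-resp-≈ᵃ (class {l = l} s) (class {l = l′} t) = class (EqClosure-∘ l′ l s t)

  quotient-isCategory : IsCategory (RawRankedCategory.category quotient)
  quotient-isCategory = record
    { equiv     = ≈ᵃ-isEquivalence
    ; ∘-resp-≈  = ∘ᵃ-resp-≈ᵃ
    ; identityˡ = λ _ → ≈ᵃ.refl
    ; identityʳ = λ { (unit refl) → unit ; (class _ _) → ≈ᵃ.refl }
    ; assoc     = ∘ᵃ-assoc
    }
    where
    module ≈ᵃ {p q} = IsEquivalence (≈ᵃ-isEquivalence {p} {q})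
    ∘ᵃ-assoc : ∀ {p q r s} (h : Arrow raw r s) (g : Arrow raw q r) (f : Arrow raw p q) →
               ((h ∘ᵃ g) ∘ᵃ f) ≈ᵃ (h ∘ᵃ (g ∘ᵃ f))
    ∘ᵃ-assoc (unit refl) _            _            = ≈ᵃ.refl
    ∘ᵃ-assoc (class _ _) (unit refl)  _            = ≈ᵃ.refl
    ∘ᵃ-assoc (class _ _) (class _ _)  (unit refl)  = ≈ᵃ.refl
    ∘ᵃ-assoc (class _ h) (class _ g)  (class _ f)  = class-≈ (assoc h g f)

  -- A `class` arrow would strictly raise the rank of `p`. Univalence, the group laws and (A5) for
  -- the quotient all follow from this.
  Arrow-Aut-trivial : ∀ {p} (f g : Arrow raw p p) → f ≈ᵃ g
  Arrow-Aut-trivial (unit _)    (unit _)    = unit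
  Arrow-Aut-trivial (unit _)    (class l _) = contradiction l (<-irrefl refl)
  Arrow-Aut-trivial (class l _) _           = contradiction l (<-irrefl refl)

  Arrow-finite : ∀ p q → Finite (IsCategory.hom-setoid quotient-isCategory p q)
  Arrow-finite p q with ∣ p ∣ <? ∣ q ∣ | p ≟ᵒ q
  -- When the rank rises every arrow is a `class`, so the classes of the generated equivalence are
  -- counted.
  ... | yes l | _ with FiniteSetoid.EqClosure-finite (hom-setoid p q) (hom-finite p q)
                         (~-dec l) (≈⇒~ l) ~-resp-≈
  ...   | k , classes = k , record
    { to        = to′
    ; from      = λ i → class l (from i)
    ; to-cong   = to′-cong
    ; from-cong = λ { refl → class (EqC.reflexive _) }
    ; inverse   = (λ {i} s → trans (to′-cong s) (strictlyInverseˡ i))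
                , (λ { {unit e} _ → contradiction l (<-irrefl (cong ∣_∣ e))
                     ; {class _ f} refl → class (strictlyInverseʳ f) })
    }
    where
    open Inverse classes
    to′ : Arrow raw p q → Fin k
    to′ (unit e)    = contradiction l (<-irrefl (cong ∣_∣ e))
    to′ (class _ f) = to f

    to′-cong : ∀ {f g} → f ≈ᵃ g → to′ f ≡ to′ g
    to′-cong (unit {e}) = contradiction l (<-irrefl (cong ∣_∣ e))
    to′-cong (class s)  = to-cong s
  Arrow-finite p q | no _ | yes refl = 1 , record
    { to        = λ _ → zero
    ; from      = λ _ → unit refl
    ; to-cong   = λ _ → refl
    ; from-cong = λ _ → unit
    ; inverse   = (λ { {zero} _ → refl }) , (λ _ → Arrow-Aut-trivial _ _)
    }
  Arrow-finite p q | no p≮q | no p≢q = 0 , record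
    { to        = λ f → ⊥-elim (empty f)
    ; from      = λ ()
    ; to-cong   = λ {f} _ → ⊥-elim (empty f)
    ; from-cong = λ { {()} }
    ; inverse   = (λ { {()} }) , (λ {f} _ → ⊥-elim (empty f))
    }
    where
    empty : Arrow raw p q → ⊥
    empty (unit e)    = p≢q e
    empty (class l _) = p≮q l

  private
    module Q = RawRankedCategory quotient

  chainᵃ : ∀ {p q} → Chain p q → Q.Chain p q
  chainᵃ [ f , r ]     = [ class (≤-reflexive (sym r)) f , r ]
  chainᵃ ((f , r) ∷ c) = (class (≤-reflexive (sym r)) f , r) ∷ chainᵃ c

  -- The inequality is existential because composition in the quotient builds its own proof of it.
  compose-chainᵃ : ∀ {p q} (c : Chain p q) → ∃[ l ] Q.compose (chainᵃ c) ≡ class l (compose c)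
  compose-chainᵃ [ _ ]         = _ , refl
  compose-chainᵃ ((_ , _) ∷ c) with compose-chainᵃ c
  ... | _ , e rewrite e = _ , refl

  quotient-isUpdown : IsUpdown quotient
  quotient-isUpdown = record
    { isCategory     = quotient-isCategory
    ; rank-isFunctor = record
      { resp-≈       = λ _ → ≤-irrelevant _ _
      ; identity     = ≤-irrelevant _ _
      ; homomorphism = λ _ _ → ≤-irrelevant _ _
      }
    ; rank-finite    = rank-finite
    ; 0̂              = 0̂
    ; ∣0̂∣            = ∣0̂∣
    ; 0̂-unique       = 0̂-unique
    ; 0̂⇒             = 0̂⇒ᵃ
    ; hom-finite     = Arrow-finite
    ; hom-empty      = λ { (unit e) → inj₂ e ; (class l _) → inj₁ l }
    ; _⁻¹            = λ f → f
    ; Aut-isGroup    = λ p → record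
      { isMonoid = record
        { isSemigroup = record
          { isMagma = record
            { isEquivalence = ≈ᵃ-isEquivalence
            ; ∙-cong        = ∘ᵃ-resp-≈ᵃ
            }
          ; assoc = λ _ _ _ → Arrow-Aut-trivial _ _
          }
        ; identity = (λ _ → Arrow-Aut-trivial _ _) , (λ _ → Arrow-Aut-trivial _ _)
        }
      ; inverse = (λ _ → Arrow-Aut-trivial _ _) , (λ _ → Arrow-Aut-trivial _ _)
      ; ⁻¹-cong = λ s → s
      }
    ; factor         = factorᵃ
    ; free-source    = λ _ _ _ _ → Arrow-Aut-trivial _ _
    ; free-target    = λ _ _ _ _ → Arrow-Aut-trivial _ _
    }
    where
    0̂⇒ᵃ : ∀ p → Arrow raw 0̂ p
    0̂⇒ᵃ p with ∣ p ∣ ≟ 0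
    ... | yes e = unit (sym (0̂-unique p e))
    ... | no ne = class (subst (_< ∣ p ∣) (sym ∣0̂∣) (n≢0⇒n>0 ne)) (0̂⇒ p)

    factorᵃ : ∀ {p q} (f : Arrow raw p q) → ∣ p ∣ < ∣ q ∣ → Σ[ c ∈ Q.Chain p q ] f ≈ᵃ Q.compose c
    factorᵃ (unit e)    l = contradiction l (<-irrefl (cong ∣_∣ e))
    factorᵃ (class _ f) l with factor f l
    ... | c , f≈c with compose-chainᵃ c
    ...   | _ , e = chainᵃ c , subst (class _ f ≈ᵃ_) (sym e) (class-≈ f≈c)

  quotientᵁ : UpdownCategory ℓ
  quotientᵁ = record { raw = quotient ; isUpdown = quotient-isUpdown }

  quotient-univalent : Univalent quotientᵁ
  quotient-univalent _ _ = Arrow-Aut-trivial _ _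

-- Functoriality of the quotient

module _ {ℓ} {C D : UpdownCategory ℓ} (F : UpdownMorphism C D) (_∼ᶜ_ : HomRel C) (_∼ᵈ_ : HomRel D) where
  open UpdownMorphism F
  private
    module C = UpdownCategory C

  Preserves : Set ℓ
  Preserves = ∀ {p q} {f g : p C.⇒ q} → f ∼ᶜ g → F₁ f ∼ᵈ F₁ g

  InjectiveOnSteps : Set ℓ
  InjectiveOnSteps = ∀ p q → C.∣ q ∣ ≡ suc C.∣ p ∣ → Injective (∐Rel _∼ᶜ_ {p} {q}) _∼ᵈ_ induced

record NaturalStepCongruence {ℓ} (_~_ : ∀ C → HomRel {ℓ} C) : Set (lsuc ℓ) where
  field
    stepCongruence : ∀ C → StepCongruence C (_~_ C)

  rel : ∀ C → HomRel C
  rel C = StepCongruence._∼_ (stepCongruence C)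

  field
    preserves : ∀ {C D} (F : UpdownMorphism C D) → Preserves F (rel C) (rel D)
    injective : ∀ {C D} (F : UpdownMorphism C D) → InjectiveOnSteps F (rel C) (rel D)

module QuotientFunctor {ℓ} {_~_ : ∀ C → HomRel {ℓ} C} (N : NaturalStepCongruence _~_) where
  open NaturalStepCongruence N

  ob : UpdownCategory ℓ → RawRankedCategory ℓ
  ob C = Quotient.quotient (UpdownCategory.raw C) (_~_ C)

  mor : ∀ {C D} → UpdownMorphism C D →
        RawFunctor (RawRankedCategory.category (ob C)) (RawRankedCategory.category (ob D))
  mor F = record { F₀ = UpdownMorphism.F₀ F ; F₁ = mapᵃ F }

  module _ {C D : UpdownCategory ℓ} (F : UpdownMorphism C D) where
    open UpdownMorphism F
    private
      module C  = UpdownCategory C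
      module D  = UpdownCategory D
      module QC = StepQuotient C (stepCongruence C)
      module QD = StepQuotient D (stepCongruence D)
      module C′ = UpdownCategory QC.quotientᵁ
      module D′ = UpdownCategory QD.quotientᵁ

    raises : ∀ {p q} → C.∣ q ∣ ≡ suc C.∣ p ∣ → D.∣ F₀ q ∣ ≡ suc D.∣ F₀ p ∣
    raises {p} {q} r = trans (rank-pres q) (trans r (cong suc (sym (rank-pres p))))

    Stepwise-map : ∀ {p q} {f g : p C.⇒ q} →
                   Stepwise C (rel C) f g → Stepwise D (rel D) (F₁ f) (F₁ g)
    Stepwise-map (step r s)         = step (raises r) (preserves F s)
    Stepwise-map (cons r s t f≈ g≈) = cons (raises r) (preserves F s) (Stepwise-map t)
      (D.Eq.trans (resp-≈ f≈) (homomorphism _ _)) (D.Eq.trans (resp-≈ g≈) (homomorphism _ _))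

    mapᵃ-isFunctor : IsFunctor (mor F)
    mapᵃ-isFunctor = record
      { resp-≈       = resp
      ; identity     = Quotient.unit
      ; homomorphism = hom
      }
      where
      ~-map : ∀ {p q} {f g : p C.⇒ q} → _~_ C f g → _~_ D (F₁ f) (F₁ g)
      ~-map s = StepCongruence.Stepwise⇒~ (stepCongruence D)
                  (Stepwise-map (StepCongruence.~⇒Stepwise (stepCongruence C) s))

      resp : ∀ {p q} {f g : Arrow C.raw p q} → f C′.≈ g → mapᵃ F f D′.≈ mapᵃ F g
      resp Quotient.unit      = Quotient.unit
      resp (Quotient.class s) = Quotient.class (EqC.gmap F₁ ~-map s)

      hom : ∀ {p q r} (g : Arrow C.raw q r) (f : Arrow C.raw p q) →
            mapᵃ F (g C′.∘ f) D′.≈ mapᵃ F g D′.∘ mapᵃ F f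
      hom (unit refl) _           = D′.Eq.refl
      hom (class _ _) (unit refl) = D′.Eq.refl
      hom (class _ g) (class _ f) = QD.class-≈ (homomorphism g f)

    subst-class : ∀ {p q q′} (e : q ≡ q′) {l : D.∣ p ∣ < D.∣ q ∣} {f : p D.⇒ q} →
                  ∃[ l′ ] subst (Arrow D.raw p) e (class l f) ≡ class l′ (subst (p D.⇒_) e f)
    subst-class refl = _ , refl

    fibre-rank : ∀ {p q q′} → C.∣ q ∣ ≡ suc C.∣ p ∣ → F₀ q′ ≡ F₀ q → C.∣ q′ ∣ ≡ suc C.∣ p ∣
    fibre-rank {q = q} {q′} r e =
      trans (sym (rank-pres q′)) (trans (cong D.∣_∣ e) (trans (rank-pres q) r))

    -- Automorphisms of the quotient are trivial, so this one statement serves both injectivity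
    -- conditions. By `EqClosure-adjacent` it reduces to `injective F`.
    mapᵃ-injective : ∀ p q → C.∣ q ∣ ≡ suc C.∣ p ∣ →
      {x y : Σ[ q′ ∈ C.Obj ] (F₀ q′ ≡ F₀ q) × Arrow C.raw p q′} →
      let induced′ = λ ((_ , e , f) : Σ[ q′ ∈ C.Obj ] (F₀ q′ ≡ F₀ q) × Arrow C.raw p q′) →
                       subst (Arrow D.raw (F₀ p)) e (mapᵃ F f) in
      induced′ x D′.≈ induced′ y →
      Σ[ e ∈ proj₁ x ≡ proj₁ y ] subst (Arrow C.raw p) e (proj₂ (proj₂ x)) C′.≈ proj₂ (proj₂ y)
    -- A `unit` would make the target equal to `p`, but lying over `F₀ q` forces its rank to be
    -- `suc ∣ p ∣`.
    mapᵃ-injective p q r {_ , e , unit refl} _ = contradiction (fibre-rank r e) (m≢1+n+m _)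
    mapᵃ-injective p q r {_} {_ , e , unit refl} _ = contradiction (fibre-rank r e) (m≢1+n+m _)
    mapᵃ-injective p q r {q′ , e , class l f} {q″ , e′ , class l′ g} s
      -- Transport is moved inside `class`, so that the equality of arrows can be matched on and
      -- yields a path of generators.
      with subst-class e {f = F₁ f} | subst-class e′ {f = F₁ g}
    ... | _ , c | _ , c′ with subst₂ D′._≈_ c c′ s
    ...   | Quotient.class t with injective F p q r {q′ , e , f} {q″ , e′ , g}
                                    (QD.EqClosure-adjacent (raises r) t)
    ...     | refl , f∼g = refl , Quotient.class (EqC.return
                             (StepCongruence.Stepwise⇒~ (stepCongruence C) (step (fibre-rank r e′) f∼g)))

    mapᵃ-isUpdownMorphism : IsUpdownMorphism QC.quotientᵁ QD.quotientᵁ (mor F)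
    mapᵃ-isUpdownMorphism = record
      { isFunctor   = mapᵃ-isFunctor
      ; rank-pres   = rank-pres
      ; Aut-inj     = λ _ _ → QC.Arrow-Aut-trivial _ _
      -- As `β` equals the identity, equality modulo automorphisms is plain equality of arrows.
      ; /source-inj = λ p q r → λ { {x} {y} (β , s) →
          let e , t = mapᵃ-injective p q r {x} {y}
                        (D′.Eq.trans (D′.Eq.trans (D′.Eq.sym (D′.identityʳ _))
                          (D′.∘-resp-≈ D′.Eq.refl (QD.Arrow-Aut-trivial D′.id β))) s)
          in e , C′.id , C′.Eq.trans (C′.identityʳ _) t }
      ; /target-inj = λ p q r → λ { {x} {y} (α , s) →
          let e , t = mapᵃ-injective p q r {x} {y}
                        (D′.Eq.trans (D′.Eq.trans (D′.Eq.sym (D′.identityˡ _))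
                          (D′.∘-resp-≈ (QD.Arrow-Aut-trivial D′.id α) D′.Eq.refl)) s)
          in e , C′.id , C′.Eq.trans (C′.identityˡ _) t }
      }

    mapᵁ : UpdownMorphism QC.quotientᵁ QD.quotientᵁ
    mapᵁ = record { raw = mor F ; isMorphism = mapᵃ-isUpdownMorphism }

  module _ {C D : UpdownCategory ℓ} where
    private
      module C = UpdownCategory C
      module D = UpdownCategory D
      module QD = StepQuotient D (stepCongruence D)
      module D′ = UpdownCategory QD.quotientᵁ

    mapᵁ-resp-≋ : {F G : UpdownMorphism C D} → UpdownMorphism.raw F ≋ UpdownMorphism.raw G →
                  mor F ≋ mor G
    mapᵁ-resp-≋ {F} {G} F≋G = record { eq₀ = eq₀ ; eq₁ = eq₁ᵃ }
      where
      open _≋_ F≋G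
      subst₂-≈ᵃ : ∀ {p p′ q q′} (e₁ : p ≡ p′) (e₂ : q ≡ q′)
                  {l : D.∣ p ∣ < D.∣ q ∣} {l′ : D.∣ p′ ∣ < D.∣ q′ ∣} {f : p D.⇒ q} {g : p′ D.⇒ q′} →
                  subst₂ D._⇒_ e₁ e₂ f D.≈ g →
                  subst₂ (Arrow D.raw) e₁ e₂ (class l f) D′.≈ class l′ g
      subst₂-≈ᵃ refl refl e = QD.class-≈ e

      subst₂-unit : ∀ {p p′ q q′} (e₁ : p ≡ p′) (e₂ : q ≡ q′) {e : p ≡ q} {e′ : p′ ≡ q′} →
                    subst₂ (Arrow D.raw) e₁ e₂ (unit e) D′.≈ unit e′
      subst₂-unit refl refl = Quotient.unit

      eq₁ᵃ : ∀ {p q} (f : Arrow C.raw p q) →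
             subst₂ (Arrow D.raw) (eq₀ p) (eq₀ q) (mapᵃ F f) D′.≈ mapᵃ G f
      eq₁ᵃ (unit e)    = subst₂-unit (eq₀ _) (eq₀ _)
      eq₁ᵃ (class l f) = subst₂-≈ᵃ (eq₀ _) (eq₀ _) (eq₁ f)

  quotientFunctor : Functor (𝔘 ℓ) (𝔘𝔘 ℓ)
  quotientFunctor = record
    { raw = record
      { F₀ = λ C → let open StepQuotient C (stepCongruence C) in quotientᵁ , quotient-univalent
      ; F₁ = mapᵁ
      }
    ; isFunctor = record
      { resp-≈       = λ {_} {_} {F} {G} → mapᵁ-resp-≋ {F = F} {G}
      ; identity     = λ {C} → mapᵁ-identity C
      ; homomorphism = λ {_} {_} {E} G F → record
        { eq₀ = λ _ → refl
        ; eq₁ = λ { (unit _)    → Quotient.unit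
                  ; (class _ _) → StepQuotient.class-≈ E (stepCongruence E) (UpdownCategory.Eq.refl E) }
        }
      }
    }
    where
    mapᵁ-identity : ∀ C → mor (idU {C = C}) ≋ idF
    mapᵁ-identity C = record
      { eq₀ = λ _ → refl
      ; eq₁ = λ { (unit _)    → Quotient.unit
                ; (class _ _) → StepQuotient.class-≈ C (stepCongruence C) (UpdownCategory.Eq.refl C) }
      }

  quotientFunctor-givenBy : GivenBy quotientFunctor ob mor
  quotientFunctor-givenBy = record
    { on-objects   = λ _ → refl
    ; on-morphisms = λ {_} {D} _ → let open StepQuotient D (stepCongruence D) in record
      { eq₀ = λ _ → refl
      ; eq₁ = λ _ → IsEquivalence.refl ≈ᵃ-isEquivalence
      }
    }

-- The two instances: target and source automorphisms

↑-naturalStepCongruence : ∀ {ℓ} → NaturalStepCongruence {ℓ} _~↑_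
↑-naturalStepCongruence = record
  { stepCongruence = ↑-stepCongruence
  -- Functoriality carries the automorphism `α` relating two maps to `F₁ α`, which relates their
  -- images.
  ; preserves      = λ {_} {D} F (α , αf≈g) → let open UpdownMorphism F; open UpdownCategory D in
      F₁ α , Eq.trans (Eq.sym (homomorphism _ _)) (resp-≈ αf≈g)
  ; injective      = UpdownMorphism./target-inj
  }

↓-naturalStepCongruence : ∀ {ℓ} → NaturalStepCongruence {ℓ} _~↓_
↓-naturalStepCongruence = record
  { stepCongruence = ↓-stepCongruence
  ; preserves      = λ {_} {D} F (β , fβ≈g) → let open UpdownMorphism F; open UpdownCategory D in
      F₁ β , Eq.trans (Eq.sym (homomorphism _ _)) (resp-≈ fβ≈g)
  ; injective      = UpdownMorphism./source-inj
  }

theorem4p1 : ∀ (ℓ : Level) →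
    (Σ[ T ∈ Functor (𝔘 ℓ) (𝔘𝔘 ℓ) ] GivenBy T _↑ _↑₁) ×
    (Σ[ T ∈ Functor (𝔘 ℓ) (𝔘𝔘 ℓ) ] GivenBy T _↓ _↓₁)
theorem4p1 ℓ =
  -- For these two instances the generic `ob` and `mor` unfold to the required constructions on
  -- objects and morphisms.
  (quotientFunctor ↑-naturalStepCongruence , quotientFunctor-givenBy ↑-naturalStepCongruence) ,
  (quotientFunctor ↓-naturalStepCongruence , quotientFunctor-givenBy ↓-naturalStepCongruence)
  where open QuotientFunctor
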